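{- For infinitely many $n\in\mathbb{N}$ there exist matroids $M=(E,\mathcal{I})$ and $M'=(E,\mathcal{I}')$ over the same ground set $E$ with $|E|=n$ and a weight function $w:E\to\{0,1\}$ such that $M$ and $M'$ have exactly two common bases $B$ and $B'$, and these satisfy: (1) $w(B)=0$ and $w(B')=1$; (2) $B\cap B'=\emptyset$ and $|B|=|B'|=n/2$.
   Context: A common basis of $M$ and $M'$ is a set that is a basis of both. $w(S)=\sum_{e\in S}w(e)$. -}

module Defs where

open import Data.Bool using (if_then_else_)
open import Data.Fin using (Fin; toℕ)
open import Data.Fin.Subset using (Subset; _∈_; _∉_; _⊆_; _∪_; ⁅_⁆; ∣_∣; ⊥)
open import Data.Nat using (ℕ; _<_)
open import Data.Product using (_×_; ∃-syntax)
open import Data.Vec using (lookup; sum; tabulate)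
open import Level using (0ℓ)
open import Relation.Binary.PropositionalEquality using (_≡_)
open import Relation.Unary using (Pred; Decidable)

-- The ground set is Fin n. Independence is required to be decidable, so that
-- the family of independent sets is a finite family of finite sets in the
-- usual sense; classically this is no restriction.
record Matroid (n : ℕ) : Set₁ where
  field
    Indep        : Pred (Subset n) 0ℓ
    indep?       : Decidable Indep
    empty        : Indep ⊥
    hereditary   : ∀ {A B} → A ⊆ B → Indep B → Indep A
    augmentation : ∀ {A B} → Indep A → Indep B → ∣ A ∣ < ∣ B ∣ →
                   ∃[ e ] (e ∈ B × e ∉ A × Indep (A ∪ ⁅ e ⁆))

  IsBasis : Pred (Subset n) 0ℓ
  IsBasis B = Indep B × (∀ S → Indep S → B ⊆ S → S ≡ B)

open Matroid public using (IsBasis)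

IsCommonBasis : ∀ {n} → Matroid n → Matroid n → Pred (Subset n) 0ℓ
IsCommonBasis M M' B = IsBasis M B × IsBasis M' B

-- Weights in {0,1} are elements of Fin 2, summed in ℕ.
weight : ∀ {n} → (Fin n → Fin 2) → Subset n → ℕ
weight w S = sum (tabulate λ e → if lookup S e then toℕ (w e) else 0)

{-# OPTIONS --safe #-}
module Submission where

open import Data.Bool using (Bool; true; false; not)
open import Data.Bool.Properties using (not-involutive)
open import Data.Empty using (⊥-elim)
open import Data.Fin using (Fin; zero; suc; fromℕ; inject₁; join; _↑ˡ_; _↑ʳ_; splitAt)
open import Data.Fin.Induction using (<-weakInduction)
open import Data.Fin.Permutation using (Permutation′; permutation; _⟨$⟩ʳ_; _⟨$⟩ˡ_; inverseˡ; inverseʳ)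
import Data.Fin.Permutation as Permutation
open import Data.Fin.Properties using (_≟_; any?; all?; suc-injective; splitAt-↑ˡ; splitAt-↑ʳ; join-splitAt)
open import Data.Fin.Relation.Unary.Top using (view; view-fromℕ; view-inject₁; ‵fromℕ; ‵inject₁)
open import Data.Fin.Subset using (Subset; _∈_; _∉_; _⊆_; _∩_; _∪_; _-_; ∁; ⁅_⁆; ∣_∣; ⊥)
open import Data.Fin.Subset.Properties
  using (_∈?_; ∉⊥; ∣⊥∣≡0; ∣⊤∣≡n; x∈⁅x⁆; x∈⁅y⁆⇒x≡y; x≢y⇒x∉⁅y⁆; x∈p∪q⁻; x∈p∪q⁺; p⊆p∪q
        ; x∈p∧x∉q⇒x∈p─q; x∈p⇒∣p-x∣<∣p∣; ⊆-antisym; ∩-inverseʳ)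
open import Data.Nat using (ℕ; zero; suc; _+_; _*_; _≤_; _<_; z≤n)
open import Data.Nat.Properties using (+-identityʳ; ≤-trans; <⇒≱; ≤-<-trans; m≤m+n; n≤1+n)
open import Data.Product using (_×_; Σ-syntax; ∃-syntax; _,_)
open import Data.Sum using (_⊎_; inj₁; inj₂; [_,_])
open import Data.Vec using ([]; _∷_; _++_; here; there; lookup; replicate)
open import Data.Vec.Properties
  using (lookup⇒[]=; []=⇒lookup; lookup-++ˡ; lookup-++ʳ; lookup-replicate; map-++; map-replicate)
open import Function using (_∘_; id)
open import Level using (0ℓ)
open import Relation.Binary.PropositionalEquality
  using (_≡_; _≢_; refl; sym; trans; cong; cong₂; subst)
open import Relation.Nullary using (¬_; yes; no; contradiction)
open import Relation.Nullary.Decidable using (¬?; _×-dec_; _→-dec_; decidable-stable)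
open import Relation.Unary using (Pred; Decidable)
open import Defs

-- View the cycle with 2m edges as a bipartite graph with m vertices on each
-- side. Colouring each edge by its endpoint on one side gives a partition
-- matroid, and likewise for the other side. The common bases of the two are
-- the perfect matchings of the cycle, which are its two alternating classes of
-- edges. The weight marks a single edge.

-- Induction on `p`: the first member takes a partner `y`, and `y` is deleted from `q`. By `unique`,
-- no later member can have `y` as its partner, so the deletion does no harm.
∣p∣≤∣q∣-by-relation : ∀ {m n} (R : Fin m → Fin n → Set) (p : Subset m) (q : Subset n) →
  (∀ {x} → x ∈ p → ∃[ y ] (y ∈ q × R x y)) →
  (∀ {x x′ y} → x ∈ p → x′ ∈ p → R x y → R x′ y → x ≡ x′) →
  ∣ p ∣ ≤ ∣ q ∣
∣p∣≤∣q∣-by-relation R []          q total unique = z≤n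
∣p∣≤∣q∣-by-relation R (false ∷ p) q total unique =
  ∣p∣≤∣q∣-by-relation (R ∘ suc) p q (total ∘ there)
    (λ x∈p x′∈p r r′ → suc-injective (unique (there x∈p) (there x′∈p) r r′))
∣p∣≤∣q∣-by-relation R (true ∷ p) q total unique with total here
... | y , y∈q , r₀ = ≤-<-trans
  (∣p∣≤∣q∣-by-relation (R ∘ suc) p (q - y) total′
    (λ x∈p x′∈p r r′ → suc-injective (unique (there x∈p) (there x′∈p) r r′)))
  (x∈p⇒∣p-x∣<∣p∣ y∈q)
  where
  total′ : ∀ {x} → x ∈ p → ∃[ z ] (z ∈ q - y × R (suc x) z)
  total′ x∈p with total (there x∈p)
  ... | z , z∈q , r = z , x∈p∧x∉q⇒x∈p─q z∈q (x≢y⇒x∉⁅y⁆ z≢y) , r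
    where
    z≢y : z ≢ y
    z≢y refl with () ← unique here (there x∈p) r₀ r

-- Partition matroids with capacity one in each colour class.

module _ {n m : ℕ} (colour : Fin n → Fin m) where

  Rainbow : Pred (Subset n) _
  Rainbow S = ∀ x y → x ∈ S → y ∈ S → colour x ≡ colour y → x ≡ y

  rainbow? : Decidable Rainbow
  rainbow? S = all? λ x → all? λ y →
    (x ∈? S) →-dec ((y ∈? S) →-dec ((colour x ≟ colour y) →-dec (x ≟ y)))

  HasColour : Subset n → Fin m → Set
  HasColour S c = ∃[ x ] (x ∈ S × colour x ≡ c)

  hasColour? : ∀ S → Decidable (HasColour S)
  hasColour? S c = any? λ x → (x ∈? S) ×-dec (colour x ≟ c)

  rainbow-extend : ∀ {S e} → Rainbow S → ¬ HasColour S (colour e) →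
                   Rainbow (S ∪ ⁅ e ⁆)
  rainbow-extend {S} {e} rainbow new x y x∈ y∈ eq
    with x∈p∪q⁻ S ⁅ e ⁆ x∈ | x∈p∪q⁻ S ⁅ e ⁆ y∈
  ... | inj₁ x∈S | inj₁ y∈S = rainbow x y x∈S y∈S eq
  ... | inj₂ x∈e | inj₂ y∈e = trans (x∈⁅y⁆⇒x≡y e x∈e) (sym (x∈⁅y⁆⇒x≡y e y∈e))
  ... | inj₁ x∈S | inj₂ y∈e =
    contradiction (x , x∈S , trans eq (cong colour (x∈⁅y⁆⇒x≡y e y∈e))) new
  ... | inj₂ x∈e | inj₁ y∈S =
    contradiction (y , y∈S , trans (sym eq) (cong colour (x∈⁅y⁆⇒x≡y e x∈e))) new

  -- If every colour of `B` occurred in `A`, relating elements of equal colour would inject `B` into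
  -- `A`. Hence some element of `B` has a colour new to `A`, and it can be added.
  rainbow-augment : ∀ {A B} → Rainbow A → Rainbow B → ∣ A ∣ < ∣ B ∣ →
                    ∃[ e ] (e ∈ B × e ∉ A × Rainbow (A ∪ ⁅ e ⁆))
  rainbow-augment {A} {B} rainbowA rainbowB ∣A∣<∣B∣
    with any? (λ e → (e ∈? B) ×-dec ¬? (hasColour? A (colour e)))
  ... | yes (e , e∈B , new) =
    e , e∈B , (λ e∈A → new (e , e∈A , refl)) , rainbow-extend rainbowA new
  ... | no none = contradiction
    (∣p∣≤∣q∣-by-relation (λ x y → colour y ≡ colour x) B A
      (λ {x} x∈B → decidable-stable (hasColour? A (colour x)) (λ new → none (x , x∈B , new)))
      (λ x∈B x′∈B r r′ → rainbowB _ _ x∈B x′∈B (trans (sym r) r′)))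
    (<⇒≱ ∣A∣<∣B∣)

  partitionMatroid : Matroid n
  partitionMatroid = record
    { Indep        = Rainbow
    ; indep?       = rainbow?
    ; empty        = λ _ _ x∈⊥ → contradiction x∈⊥ ∉⊥
    ; hereditary   = λ A⊆B rainbow x y x∈A y∈A → rainbow x y (A⊆B x∈A) (A⊆B y∈A)
    ; augmentation = rainbow-augment
    }

  -- Since `S` is a transversal of the colour classes, any element of a rainbow superset has the
  -- colour of some element of `S` and so equals it.
  section⇒basis : ∀ {S} (s : Fin m → Fin n) → (∀ c → s c ∈ S) → (∀ c → colour (s c) ≡ c) →
                  (∀ {x} → x ∈ S → s (colour x) ≡ x) → IsBasis partitionMatroid S
  section⇒basis {S} s s∈S colour∘s s∘colour = rainbow , maximal
    where
    rainbow : Rainbow S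
    rainbow x y x∈S y∈S eq = trans (sym (s∘colour x∈S)) (trans (cong s eq) (s∘colour y∈S))
    maximal : ∀ T → Rainbow T → S ⊆ T → T ≡ S
    maximal T rainbowT S⊆T = ⊆-antisym
      (λ {x} x∈T → subst (_∈ S)
        (rainbowT (s (colour x)) x (S⊆T (s∈S _)) x∈T (colour∘s _)) (s∈S _))
      S⊆T

  -- An element of a missing colour could be added to `S`, so by maximality it would already lie in
  -- `S`.
  basis⇒hasColour : ∀ {S} → IsBasis partitionMatroid S → ∀ x → HasColour S (colour x)
  basis⇒hasColour {S} (rainbow , maximal) x = decidable-stable (hasColour? S (colour x)) λ new →
    new (x , subst (x ∈_) (maximal (S ∪ ⁅ x ⁆) (rainbow-extend rainbow new) (p⊆p∪q ⁅ x ⁆))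
               (x∈p∪q⁺ (inj₂ (x∈⁅x⁆ x)))
           , refl)

-- The two classes of edges.

+-elim : ∀ m {n} (P : Pred (Fin (m + n)) 0ℓ) →
         (∀ i → P (i ↑ˡ n)) → (∀ j → P (m ↑ʳ j)) → ∀ x → P x
+-elim m {n} P l r x = subst P (join-splitAt m n x) (go (splitAt m x))
  where
  go : ∀ s → P (join m n s)
  go (inj₁ i) = l i
  go (inj₂ j) = r j

↑ˡ≢↑ʳ : ∀ {m n} {i : Fin m} {j : Fin n} → i ↑ˡ n ≢ m ↑ʳ j
↑ˡ≢↑ʳ {m} {n} {i} {j} eq
  with () ← trans (sym (splitAt-↑ˡ m i n)) (trans (cong (splitAt m) eq) (splitAt-↑ʳ m n j))

∣p++q∣≡∣p∣+∣q∣ : ∀ {m n} (p : Subset m) (q : Subset n) → ∣ p ++ q ∣ ≡ ∣ p ∣ + ∣ q ∣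
∣p++q∣≡∣p∣+∣q∣ []          q = refl
∣p++q∣≡∣p∣+∣q∣ (true  ∷ p) q = cong suc (∣p++q∣≡∣p∣+∣q∣ p q)
∣p++q∣≡∣p∣+∣q∣ (false ∷ p) q = ∣p++q∣≡∣p∣+∣q∣ p q

lookup-injective : ∀ {n} {p q : Subset n} → (∀ x → lookup p x ≡ lookup q x) → p ≡ q
lookup-injective {p = p} {q} eq = ⊆-antisym
  (λ {x} x∈p → lookup⇒[]= x q (trans (sym (eq x)) ([]=⇒lookup x∈p)))
  (λ {x} x∈q → lookup⇒[]= x p (trans (eq x) ([]=⇒lookup x∈q)))

-- The edges are i ↑ˡ m and m ↑ʳ j; side true consists of the former.
side : ∀ m → Bool → Subset (m + m)
side m b = replicate m b ++ replicate m (not b)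

module _ {m : ℕ} where

  lookup-sideˡ : ∀ b i → lookup (side m b) (i ↑ˡ m) ≡ b
  lookup-sideˡ b i = trans (lookup-++ˡ (replicate m b) _ i) (lookup-replicate i b)

  lookup-sideʳ : ∀ b j → lookup (side m b) (m ↑ʳ j) ≡ not b
  lookup-sideʳ b j = trans (lookup-++ʳ (replicate m b) _ j) (lookup-replicate j (not b))

  ∁-side : ∀ b → ∁ (side m b) ≡ side m (not b)
  ∁-side b = trans (map-++ not (replicate m b) _)
    (cong₂ _++_ (map-replicate not b m) (map-replicate not (not b) m))

  ∣side∣≡m : ∀ b → ∣ side m b ∣ ≡ m
  ∣side∣≡m true  = trans (∣p++q∣≡∣p∣+∣q∣ (replicate m true) _)
    (trans (cong₂ _+_ (∣⊤∣≡n m) (∣⊥∣≡0 m)) (+-identityʳ m))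
  ∣side∣≡m false = trans (∣p++q∣≡∣p∣+∣q∣ (replicate m false) _)
    (cong₂ _+_ (∣⊥∣≡0 m) (∣⊤∣≡n m))

  module _ (π : Permutation′ m) where

    -- Vertex `c` meets exactly two edges, one of each class: the left edge with index `π ⟨$⟩ˡ c`
    -- and the right edge with index `c`.
    endpoint : Fin (m + m) → Fin m
    endpoint = [ π ⟨$⟩ʳ_ , id ] ∘ splitAt m

    endpoint-↑ˡ : ∀ i → endpoint (i ↑ˡ m) ≡ π ⟨$⟩ʳ i
    endpoint-↑ˡ i = cong [ π ⟨$⟩ʳ_ , id ] (splitAt-↑ˡ m i m)

    endpoint-↑ʳ : ∀ j → endpoint (m ↑ʳ j) ≡ j
    endpoint-↑ʳ j = cong [ π ⟨$⟩ʳ_ , id ] (splitAt-↑ʳ m m j)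

    endpointMatroid : Matroid (m + m)
    endpointMatroid = partitionMatroid endpoint

    side-basis : ∀ b → IsBasis endpointMatroid (side m b)
    side-basis true = section⇒basis endpoint (λ c → (π ⟨$⟩ˡ c) ↑ˡ m)
      (λ c → lookup⇒[]= _ _ (lookup-sideˡ true _))
      (λ c → trans (endpoint-↑ˡ _) (inverseʳ π))
      (λ {x} → +-elim m (λ x → x ∈ side m true → (π ⟨$⟩ˡ endpoint x) ↑ˡ m ≡ x)
        (λ i _ → cong (_↑ˡ m) (trans (cong (π ⟨$⟩ˡ_) (endpoint-↑ˡ i)) (inverseˡ π)))
        (λ j j∈ → contradiction (trans (sym ([]=⇒lookup j∈)) (lookup-sideʳ true j)) λ ())
        x)
    side-basis false = section⇒basis endpoint (m ↑ʳ_)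
      (λ c → lookup⇒[]= _ _ (lookup-sideʳ false _))
      endpoint-↑ʳ
      (λ {x} → +-elim m (λ x → x ∈ side m false → m ↑ʳ endpoint x ≡ x)
        (λ i i∈ → contradiction (trans (sym ([]=⇒lookup i∈)) (lookup-sideˡ false i)) λ ())
        (λ j _ → cong (m ↑ʳ_) (endpoint-↑ʳ j))
        x)

    -- The two edges concerned are the only ones at vertex `π ⟨$⟩ʳ i`. Independence excludes taking
    -- both, and maximality excludes taking neither.
    basis-alternates : ∀ {S} → IsBasis endpointMatroid S → ∀ i →
                       lookup S (m ↑ʳ (π ⟨$⟩ʳ i)) ≡ not (lookup S (i ↑ˡ m))
    basis-alternates {S} basis@(rainbow , _) i
      with lookup S (i ↑ˡ m) in eqˡ | lookup S (m ↑ʳ (π ⟨$⟩ʳ i)) in eqʳ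
    ... | true  | false = refl
    ... | false | true  = refl
    ... | true  | true  = contradiction
      (rainbow _ _ (lookup⇒[]= _ S eqˡ) (lookup⇒[]= _ S eqʳ)
        (trans (endpoint-↑ˡ i) (sym (endpoint-↑ʳ _))))
      ↑ˡ≢↑ʳ
    -- Maximality gives a member `y` of `S` at this vertex. If `y` is a left edge, injectivity of
    -- `π` makes its index `i`; if it is a right edge, its index is `π ⟨$⟩ʳ i`. Both edges are
    -- absent.
    ... | false | false with basis⇒hasColour endpoint basis (i ↑ˡ m)
    ... | y , y∈S , eq = ⊥-elim (+-elim m
      (λ y → y ∈ S → ¬ endpoint y ≡ π ⟨$⟩ʳ i)
      (λ i′ i′∈S eq′ → absent eqˡ (subst (λ k → (k ↑ˡ m) ∈ S)
        (trans (sym (inverseˡ π)) (trans (cong (π ⟨$⟩ˡ_) (trans (sym (endpoint-↑ˡ i′)) eq′)) (inverseˡ π))) i′∈S))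
      (λ j j∈S eq′ → absent eqʳ (subst (λ k → (m ↑ʳ k) ∈ S)
        (trans (sym (endpoint-↑ʳ j)) eq′) j∈S))
      y y∈S (trans eq (endpoint-↑ˡ i)))
      where
      absent : ∀ {x} → lookup S x ≡ false → x ∉ S
      absent eq x∈S with () ← trans (sym eq) ([]=⇒lookup x∈S)

-- The cycle and its perfect matchings.

cyclicPred : ∀ k → Permutation′ (suc k)
cyclicPred k = permutation prev next prev∘next next∘prev
  where
  prev : Fin (suc k) → Fin (suc k)
  prev zero    = fromℕ k
  prev (suc i) = inject₁ i
  next : Fin (suc k) → Fin (suc k)
  next j with view j
  ... | ‵fromℕ     = zero
  ... | ‵inject₁ i = suc i
  prev∘next : ∀ j → prev (next j) ≡ j
  prev∘next j with view j
  ... | ‵fromℕ     = refl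
  ... | ‵inject₁ i = refl
  next∘prev : ∀ i → next (prev i) ≡ i
  next∘prev zero    rewrite view-fromℕ k   = refl
  next∘prev (suc i) rewrite view-inject₁ i = refl

module _ (k : ℕ) where

  -- In `M₁` the left edge `i` meets the right edge `i`; in `M₂` it meets the right edge `i - 1`,
  -- cyclically. Alternating between the two adjacencies runs through all edges in a single cycle.
  M₁ M₂ : Matroid (suc k + suc k)
  M₁ = endpointMatroid {suc k} Permutation.id
  M₂ = endpointMatroid (cyclicPred k)

  -- Membership alternates along the cycle, so the status of edge `zero` determines all of `S`.
  commonBasis⇒side : ∀ {S} → IsCommonBasis M₁ M₂ S →
                     S ≡ side (suc k) (lookup S zero)
  commonBasis⇒side {S} (basis₁ , basis₂) = lookup-injective
    (+-elim (suc k) (λ x → lookup S x ≡ lookup (side (suc k) b) x)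
      (λ i → trans (left i) (sym (lookup-sideˡ b i)))
      (λ j → trans (alt₁ j) (trans (cong not (left j)) (sym (lookup-sideʳ b j)))))
    where
    b = lookup S zero
    alt₁ = basis-alternates {suc k} Permutation.id basis₁
    alt₂ = basis-alternates (cyclicPred k) basis₂
    not-injective : ∀ {x y} → not x ≡ not y → x ≡ y
    not-injective {x} {y} eq =
      trans (sym (not-involutive x)) (trans (cong not eq) (not-involutive y))
    left : ∀ i → lookup S (i ↑ˡ suc k) ≡ b
    -- The right edge `inject₁ i` is complementary to the left edge `suc i` through `M₂` and to the
    -- left edge `inject₁ i` through `M₁`, so these two left edges have the same status.
    left = <-weakInduction _ refl λ i ih →
      trans (not-injective (trans (sym (alt₂ (suc i))) (alt₁ (inject₁ i)))) ih

weight-zero : ∀ {n} (S : Subset n) → weight (λ _ → zero) S ≡ 0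
weight-zero []          = refl
weight-zero (true  ∷ S) = weight-zero S
weight-zero (false ∷ S) = weight-zero S

theorem19 : (N : ℕ) → Σ[ n ∈ ℕ ] (N ≤ n ×
    (Σ[ M ∈ Matroid n ] Σ[ M' ∈ Matroid n ] Σ[ w ∈ (Fin n → Fin 2) ]
    Σ[ B ∈ Subset n ] Σ[ B' ∈ Subset n ]
    ( IsCommonBasis M M' B
    × IsCommonBasis M M' B'
    × B ≢ B'
    × (∀ S → IsCommonBasis M M' S → S ≡ B ⊎ S ≡ B')
    × weight w B ≡ 0
    × weight w B' ≡ 1
    × B ∩ B' ≡ ⊥
    × 2 * ∣ B ∣ ≡ n
    × 2 * ∣ B' ∣ ≡ n )))
theorem19 N =
  -- The marked edge `zero` is a left edge, so `side m false` avoids it and plays the role of `B`.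
  m + m , ≤-trans (n≤1+n N) (m≤m+n m m) , M₁ N , M₂ N , w , side m false , side m true ,
  common false , common true , (λ ()) , only , weight-zero (tail false) ,
  cong suc (weight-zero (tail true)) , disjoint , size false , size true
  where
  m = suc N
  w : Fin (m + m) → Fin 2
  w zero    = suc zero
  w (suc _) = zero
  -- `side m b` computes to `b ∷ tail b`, and the weight is constantly zero on the tail.
  tail : Bool → Subset (N + m)
  tail b = replicate N b ++ replicate m (not b)
  common : ∀ b → IsCommonBasis (M₁ N) (M₂ N) (side m b)
  common b = side-basis {m} Permutation.id b , side-basis (cyclicPred N) b
  only : ∀ S → IsCommonBasis (M₁ N) (M₂ N) S → S ≡ side m false ⊎ S ≡ side m true
  only S common with lookup S zero | commonBasis⇒side N common
  ... | false | eq = inj₁ eq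
  ... | true  | eq = inj₂ eq
  disjoint : side m false ∩ side m true ≡ ⊥
  disjoint = trans (cong (side m false ∩_) (sym (∁-side {m} false))) (∩-inverseʳ (side m false))
  size : ∀ b → 2 * ∣ side m b ∣ ≡ m + m
  size b = trans (cong (2 *_) (∣side∣≡m {m} b)) (cong (m +_) (+-identityʳ m))
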